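{- Fix integers $s,t\ge 3$ with $R(s-1,t)\ge R(s,t-1)$, and set $M=R(s-1,t)$ and $m=R(s,t-1)$. Let $0<\varepsilon<\frac{1}{M+1}$ and set $\alpha=\frac{1}{M+1}-\varepsilon$. Then there exists a positive integer $n$ such that $\alpha n$ is an integer and every red/blue edge-coloring of the Kneser graph $\mathrm{KG}(n,\alpha n)$ contains a red $K_s$ or a blue $K_t$.
   Context: $R(a,b)$ is the classical Ramsey number: the least $n$ such that every red/blue edge-coloring of $K_n$ contains a red $K_a$ or a blue $K_b$. The Kneser graph $\mathrm{KG}(n,r)$ has vertex set the $r$-element subsets of $[n]=\{1,\dots,n\}$, with two sets adjacent iff they are disjoint. A red $K_s$ is a set of $s$ pairwise adjacent vertices all of whose connecting edges are red; similarly for a blue $K_t$.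
   Formalization: ε is taken to be rational; for irrational ε the number α is irrational, so αn is never an integer for positive n and the claim as stated would fail. -}

module Defs where

open import Data.Nat using (ℕ; suc; _<_)
open import Data.Bool using (Bool; true; false)
open import Data.Fin using (Fin)
open import Data.Fin.Subset using (Subset; ∣_∣; _∩_; Empty)
open import Data.Product using (Σ; _×_)
open import Data.Sum using (_⊎_)
open import Relation.Binary.PropositionalEquality using (_≡_; _≢_)
open import Relation.Nullary using (¬_)
open import Function.Definitions using (Injective)

red blue : Bool
red = true
blue = false

SymColouring : Set → Set
SymColouring V = Σ (V → V → Bool) λ c → ∀ x y → c x y ≡ c y x

MonoClique : {V : Set} → (V → V → Set) → (V → V → Bool) → Bool → ℕ → Set
MonoClique {V} Adj c col k =
  Σ (Fin k → V) λ f → Injective _≡_ _≡_ f ×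
    (∀ i j → i ≢ j → Adj (f i) (f j) × c (f i) (f j) ≡ col)

KAdj : {N : ℕ} → Fin N → Fin N → Set
KAdj i j = i ≢ j

Arrows : ℕ → ℕ → ℕ → Set
Arrows N a b = (c : SymColouring (Fin N)) →
  MonoClique KAdj (Σ.proj₁ c) red a ⊎ MonoClique KAdj (Σ.proj₁ c) blue b
  where open Σ

IsRamseyNumber : ℕ → ℕ → ℕ → Set
IsRamseyNumber a b N = Arrows N a b × (∀ k → k < N → ¬ Arrows k a b)

KVertex : ℕ → ℕ → Set
KVertex n r = Σ (Subset n) λ p → ∣ p ∣ ≡ r

KneserAdj : {n r : ℕ} → KVertex n r → KVertex n r → Set
KneserAdj p q = Empty (Σ.proj₁ p ∩ Σ.proj₁ q)

KneserArrows : ℕ → ℕ → ℕ → ℕ → Set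
KneserArrows n r s t = (c : SymColouring (KVertex n r)) →
  MonoClique KneserAdj (Σ.proj₁ c) red s ⊎ MonoClique KneserAdj (Σ.proj₁ c) blue t

{-# OPTIONS --safe #-}

-- Fix a vertex v and colour the r-sets disjoint from v by the colour of their
-- edge to v.  If M pairwise disjoint r-sets get the same colour, then
-- R(s-1,t) = M (red) or R(s,t-1) = m ≤ M (blue) applied to them gives the clique,
-- extended by v if necessary.  Such r-sets exist among any M (r + 1) points:
-- list the points and slide a window of length r along them.  Either the
-- windows all have one colour, and consecutive blocks of length r will do, or
-- two consecutive windows differ; in that case delete the r + 1 points they
-- cover, find M - 1 r-sets of one colour by induction, and add the window of
-- that colour.  Since α (M + 1) < 1, there are r + M (r + 1) points for n large.
module Submission where

open import Defs
open import Data.Nat using (ℕ; suc; _≤_; _∸_)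
open import Data.Integer using (+_)
open import Data.Rational using (ℚ; _/_; _-_; _*_; _<_; 0ℚ)
open import Data.Product using (Σ; _×_)
open import Relation.Binary.PropositionalEquality using (_≡_)

open import Data.Bool using (Bool; true; false)
open import Data.Bool.Properties using () renaming (_≟_ to _≟ᵇ_)
open import Data.Fin using (Fin; zero; suc; inject≤)
open import Data.Fin.Properties using (inject≤-injective) renaming (_≟_ to _≟ᶠ_)
open import Data.Fin.Subset using (Subset; ∣_∣; _∩_; _∪_; Empty; ⊥; ⁅_⁆; _∉_)
  renaming (_∈_ to _∈ˢ_)
open import Data.Fin.Subset.Properties
  using (∣⊥∣≡0; ∉⊥; ∪-identityˡ; ∩-comm; ∩-idem; Empty-unique; x∈p∪q⁻; x∈p∩q⁻; x∈⁅y⁆⇒x≡y)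
import Data.Integer as ℤ
import Data.Integer.Properties as ℤ
open import Data.List using (List; []; _∷_; _++_; length; take; drop; allFin)
open import Data.List.Membership.Propositional using (_∈_)
open import Data.List.Membership.Propositional.Properties using (∈-++⁺ˡ; ∈-++⁺ʳ)
open import Data.List.Properties
  using (length-take; length-drop; length-++; length-tabulate; take++drop≡id; drop-drop)
open import Data.List.Relation.Binary.Disjoint.Propositional using (Disjoint)
open import Data.List.Relation.Binary.Permutation.Propositional
  using (_↭_; ↭-sym; ↭-trans; ↭-reflexive; ↭⇒↭ₛ)
open import Data.List.Relation.Binary.Permutation.Propositional.Properties
  using (∈-resp-↭; ↭-length; shifts)
open import Data.List.Relation.Binary.Permutation.Setoid.Properties using (Unique-resp-↭)
open import Data.List.Relation.Binary.Subset.Propositional using (_⊆_)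
import Data.List.Relation.Unary.All as All
open import Data.List.Relation.Unary.All.Properties using (++⁻ʳ)
open import Data.List.Relation.Unary.Any using (here; there)
open import Data.List.Relation.Unary.Unique.Propositional using (Unique; []; _∷_)
open import Data.List.Relation.Unary.Unique.Propositional.Properties
  using (take⁺; drop⁺; allFin⁺; Unique[x∷xs]⇒x∉xs)
open import Data.Nat as ℕ using (zero)
import Data.Nat.Properties as ℕ
open import Data.Nat.Tactic.RingSolver using (solve-∀)
import Data.Rational as ℚ
import Data.Rational.Properties as ℚ
import Data.Rational.Unnormalised as ℚᵘ
import Data.Rational.Unnormalised.Properties as ℚᵘ
open import Data.Product using (_,_; proj₁; proj₂; ∃-syntax)
open import Data.Sum using (_⊎_; inj₁; inj₂; map)
open import Data.Vec using ([]; _∷_; here; there)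
open import Function using (_∘_; case_of_)
open import Relation.Binary.PropositionalEquality
  using (_≢_; refl; sym; trans; cong; subst; setoid)
open import Relation.Nullary using (¬_; yes; no; contradiction)

m+n≤o⇒n≤o∸m : ∀ m {n o} → m ℕ.+ n ≤ o → n ≤ o ∸ m
m+n≤o⇒n≤o∸m m {n} {o} le = ℕ.m+n≤o⇒m≤o∸n n (subst (_≤ o) (ℕ.+-comm m n) le)

-- Lists without repetitions

module _ {A : Set} where

  Unique-++⁻ʳ : ∀ xs {ys : List A} → Unique (xs ++ ys) → Unique ys
  Unique-++⁻ʳ []       u       = u
  Unique-++⁻ʳ (x ∷ xs) (_ ∷ u) = Unique-++⁻ʳ xs u

  Unique-++⇒Disjoint : ∀ xs {ys : List A} → Unique (xs ++ ys) → Disjoint xs ys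
  Unique-++⇒Disjoint (x ∷ xs) (p ∷ _) (here refl , y∈) = All.lookup (++⁻ʳ xs p) y∈ refl
  Unique-++⇒Disjoint (x ∷ xs) (_ ∷ u) (there x∈ , y∈)  = Unique-++⇒Disjoint xs u (x∈ , y∈)

  -- Together with `take-suc-⊆`, this keeps two consecutive windows of length `n` inside the `suc n`
  -- points that they cover.
  take-drop-suc-⊆ : ∀ n i (xs : List A) → take n (drop (suc i) xs) ⊆ take (suc n) (drop i xs)
  take-drop-suc-⊆ zero    _       _        ()
  take-drop-suc-⊆ (suc n) zero    []       ()
  take-drop-suc-⊆ (suc n) (suc i) []       ()
  take-drop-suc-⊆ (suc n) zero    (x ∷ xs) y∈ = there y∈
  take-drop-suc-⊆ (suc n) (suc i) (x ∷ xs) y∈ = take-drop-suc-⊆ (suc n) i xs y∈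

  take-suc-⊆ : ∀ n (xs : List A) → take n xs ⊆ take (suc n) xs
  take-suc-⊆ (suc n) (x ∷ xs) (here p)   = here p
  take-suc-⊆ (suc n) (x ∷ xs) (there y∈) = there (take-suc-⊆ n xs y∈)

-- Equality passes from neighbour to neighbour, so a sequence that is not constant changes
-- somewhere; `i < N` keeps `suc i` in range too.
constant-or-change : (a : ℕ → Bool) (N : ℕ) →
  (∃[ i ] i ℕ.< N × a i ≢ a (suc i)) ⊎ (∀ i → i ≤ N → a i ≡ a 0)
constant-or-change a zero = inj₂ λ { zero _ → refl }
constant-or-change a (suc N) with constant-or-change (a ∘ suc) N
... | inj₁ (i , i<N , ≢) = inj₁ (suc i , ℕ.s≤s i<N , ≢)
... | inj₂ const with a 0 ≟ᵇ a 1
...   | no ≢   = inj₁ (0 , ℕ.s≤s ℕ.z≤n , ≢)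
...   | yes ≡₁ = inj₂ λ { zero _ → refl ; (suc i) (ℕ.s≤s i≤N) → trans (const i i≤N) (sym ≡₁) }

-- Two distinct colours are all the colours, so a pair of differently coloured windows can match
-- whichever colour the induction returns.
≢⇒one-equals : {x y : Bool} → x ≢ y → ∀ b → x ≡ b ⊎ y ≡ b
≢⇒one-equals {true}  {true}  ≢ _     = contradiction refl ≢
≢⇒one-equals {false} {false} ≢ _     = contradiction refl ≢
≢⇒one-equals {true}  {false} _ true  = inj₁ refl
≢⇒one-equals {true}  {false} _ false = inj₂ refl
≢⇒one-equals {false} {true}  _ true  = inj₂ refl
≢⇒one-equals {false} {true}  _ false = inj₁ refl

-- Disjoint blocks of one colour

module _ {A : Set} (χ : List A → Bool) (r : ℕ) where

  record Block (xs : List A) (col : Bool) (b : List A) : Set where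
    field
      unique  : Unique b
      size    : length b ≡ r
      within  : b ⊆ xs
      colour  : χ b ≡ col

  record Packing (xs : List A) (col : Bool) (j : ℕ) : Set where
    field
      block    : Fin j → List A
      isBlock  : ∀ i → Block xs col (block i)
      disjoint : ∀ i k → i ≢ k → Disjoint (block i) (block k)

  open Block
  open Packing

  empty-packing : ∀ {xs col} → Packing xs col 0
  empty-packing = record { block = λ () ; isBlock = λ () ; disjoint = λ () }

  -- Uniqueness of `xs` makes `ys` and `zs` disjoint, so the new block misses all the old ones. A
  -- permutation is allowed because the deleted points may lie in the middle of the list.
  add-block : ∀ {xs ys zs b col j} → Unique xs → xs ↭ ys ++ zs →
    Block ys col b → Packing zs col j → Packing xs col (suc j)
  add-block {xs} {ys} {zs} {b} {col} {j} u xs↭ B P =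
    record { block = block′ ; isBlock = isBlock′ ; disjoint = disjoint′ }
    where
    ys∩zs : Disjoint ys zs
    ys∩zs = Unique-++⇒Disjoint ys (Unique-resp-↭ (setoid A) (↭⇒↭ₛ xs↭) u)

    block′ : Fin (suc j) → List A
    block′ zero    = b
    block′ (suc i) = block P i

    widen : ∀ {vs c} → vs ⊆ ys ++ zs → Block vs col c → Block xs col c
    widen vs⊆ C = record
      { unique = unique C ; size = size C ; colour = colour C
      ; within = ∈-resp-↭ (↭-sym xs↭) ∘ vs⊆ ∘ within C }

    isBlock′ : ∀ i → Block xs col (block′ i)
    isBlock′ zero    = widen ∈-++⁺ˡ B
    isBlock′ (suc i) = widen (∈-++⁺ʳ ys) (isBlock P i)

    disjoint′ : ∀ i k → i ≢ k → Disjoint (block′ i) (block′ k)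
    disjoint′ zero    zero    i≢k           = contradiction refl i≢k
    disjoint′ zero    (suc k) _   (x∈ , y∈) = ys∩zs (within B x∈ , within (isBlock P k) y∈)
    disjoint′ (suc i) zero    _   (x∈ , y∈) = ys∩zs (within B y∈ , within (isBlock P i) x∈)
    disjoint′ (suc i) (suc k) i≢k           = disjoint P i k (i≢k ∘ cong suc)

  window : ℕ → List A → List A
  window i xs = take r (drop i xs)

  window-isBlock : ∀ {ys xs col} i → Unique xs → i ℕ.+ r ≤ length xs →
    window i xs ⊆ ys → χ (window i xs) ≡ col → Block ys col (window i xs)
  window-isBlock {xs = xs} i u i+r≤ ⊆ys eq = record
    { unique = take⁺ r (drop⁺ i u)
    ; size   = trans (length-take r (drop i xs)) (ℕ.m≤n⇒m⊓n≡m
                 (subst (r ≤_) (sym (length-drop i xs)) (m+n≤o⇒n≤o∸m i i+r≤)))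
    ; within = ⊆ys
    ; colour = eq }

  -- Windows of `drop r xs` are windows of `xs` shifted by `r`, so cutting off the first block
  -- preserves the hypothesis on colours.
  consecutive-blocks : ∀ j {xs col} → Unique xs → j ℕ.* r ≤ length xs →
    (∀ i → i ℕ.+ r ≤ length xs → χ (window i xs) ≡ col) → Packing xs col j
  consecutive-blocks zero               u j*r≤ const = empty-packing
  consecutive-blocks (suc j) {xs} {col} u j*r≤ const =
    add-block u (↭-reflexive (sym (take++drop≡id r xs)))
      (window-isBlock 0 u r≤ (λ x∈ → x∈) (const 0 r≤))
      (consecutive-blocks j (drop⁺ r u)
        (subst (j ℕ.* r ≤_) (sym (length-drop r xs)) (m+n≤o⇒n≤o∸m r j*r≤))
        λ i i+r≤ → subst (λ ys → χ (take r ys) ≡ col) (sym (drop-drop r i xs))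
          (const (r ℕ.+ i) (subst (_≤ length xs) (sym (ℕ.+-assoc r i r))
            (ℕ.≤-trans (ℕ.+-monoʳ-≤ r (subst (i ℕ.+ r ≤_) (length-drop r xs) i+r≤))
              (ℕ.≤-reflexive (ℕ.m+[n∸m]≡n r≤))))))
    where
    r≤ : r ≤ length xs
    r≤ = ℕ.m+n≤o⇒m≤o r j*r≤

  monochromatic-packing : ∀ j {xs} → Unique xs → j ℕ.* suc r ≤ length xs →
    ∃[ col ] Packing xs col j
  -- Without blocks either colour is correct; `true` is an arbitrary choice.
  monochromatic-packing zero    u _ = true , empty-packing
  monochromatic-packing (suc j) {xs} u j*≤
    -- The last full window starts at `length xs ∸ r`.
    with constant-or-change (λ i → χ (window i xs)) (length xs ∸ r)
  ... | inj₂ const = _ , consecutive-blocks (suc j) u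
          (ℕ.≤-trans (ℕ.*-monoʳ-≤ (suc j) (ℕ.n≤1+n r)) j*≤)
          λ i i+r≤ → const i (ℕ.m+n≤o⇒m≤o∸n i i+r≤)
  ... | inj₁ (i , i<N , differ) = col , packing (≢⇒one-equals differ col)
    where
    covered = take (suc r) (drop i xs)
    rest    = take i xs ++ drop (suc r) (drop i xs)

    r≤ : r ≤ length xs
    r≤ = ℕ.≤-trans (ℕ.n≤1+n r) (ℕ.m+n≤o⇒m≤o (suc r) j*≤)

    1+i+r≤ : suc i ℕ.+ r ≤ length xs
    1+i+r≤ = ℕ.≤-trans (ℕ.+-monoˡ-≤ r i<N) (ℕ.≤-reflexive (ℕ.m∸n+n≡m r≤))

    xs↭ : xs ↭ covered ++ rest
    xs↭ = ↭-trans
      (↭-reflexive (sym (trans (cong (take i xs ++_) (take++drop≡id (suc r) (drop i xs)))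
        (take++drop≡id i xs))))
      (shifts (take i xs) covered)

    covered≤ : length covered ≤ suc r
    covered≤ = subst (_≤ suc r) (sym (length-take (suc r) (drop i xs))) (ℕ.m⊓n≤m (suc r) _)

    rest≥ : j ℕ.* suc r ≤ length rest
    -- At most `suc r` points are deleted, which is the share of one block in `j*≤`.
    rest≥ = ℕ.+-cancelˡ-≤ (suc r) _ _ (ℕ.≤-trans j*≤
      (ℕ.≤-trans (ℕ.≤-reflexive (trans (↭-length xs↭) (length-++ covered)))
        (ℕ.+-monoˡ-≤ (length rest) covered≤)))

    smaller : ∃[ col ] Packing rest col j
    smaller = monochromatic-packing j
      (Unique-++⁻ʳ covered (Unique-resp-↭ (setoid A) (↭⇒↭ₛ xs↭) u)) rest≥

    col = proj₁ smaller

    packing : χ (window i xs) ≡ col ⊎ χ (window (suc i) xs) ≡ col → Packing xs col (suc j)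
    packing (inj₁ eq) = add-block u xs↭
      (window-isBlock i u (ℕ.≤-trans (ℕ.n≤1+n _) 1+i+r≤) (take-suc-⊆ r (drop i xs)) eq)
      (proj₂ smaller)
    packing (inj₂ eq) = add-block u xs↭
      (window-isBlock (suc i) u 1+i+r≤ (take-drop-suc-⊆ r i xs) eq)
      (proj₂ smaller)

-- Lists as subsets

fromList : ∀ {n} → List (Fin n) → Subset n
fromList []       = ⊥
fromList (x ∷ xs) = ⁅ x ⁆ ∪ fromList xs

∈-fromList⁻ : ∀ {n} (xs : List (Fin n)) {y} → y ∈ˢ fromList xs → y ∈ xs
∈-fromList⁻ []       y∈ = contradiction y∈ ∉⊥
∈-fromList⁻ (x ∷ xs) y∈ with x∈p∪q⁻ ⁅ x ⁆ (fromList xs) y∈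
... | inj₁ y∈x  = here (x∈⁅y⁆⇒x≡y x y∈x)
... | inj₂ y∈xs = there (∈-fromList⁻ xs y∈xs)

∣⁅x⁆∪p∣ : ∀ {n} (x : Fin n) (p : Subset n) → x ∉ p → ∣ ⁅ x ⁆ ∪ p ∣ ≡ suc ∣ p ∣
∣⁅x⁆∪p∣ zero    (true  ∷ p) x∉p = contradiction here x∉p
∣⁅x⁆∪p∣ zero    (false ∷ p) x∉p = cong (suc ∘ ∣_∣) (∪-identityˡ p)
∣⁅x⁆∪p∣ (suc x) (true  ∷ p) x∉p = cong suc (∣⁅x⁆∪p∣ x p (x∉p ∘ there))
∣⁅x⁆∪p∣ (suc x) (false ∷ p) x∉p = ∣⁅x⁆∪p∣ x p (x∉p ∘ there)

∣fromList∣ : ∀ {n} {xs : List (Fin n)} → Unique xs → ∣ fromList xs ∣ ≡ length xs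
∣fromList∣ {n} {[]}     _           = ∣⊥∣≡0 n
∣fromList∣ {n} {x ∷ xs} u@(_ ∷ xs!) =
  trans (∣⁅x⁆∪p∣ x (fromList xs) (Unique[x∷xs]⇒x∉xs u ∘ ∈-fromList⁻ xs))
    (cong suc (∣fromList∣ xs!))

fromList-disjoint : ∀ {n} {xs ys : List (Fin n)} → Disjoint xs ys →
  Empty (fromList xs ∩ fromList ys)
fromList-disjoint {xs = xs} {ys} d (z , z∈) =
  let z∈xs , z∈ys = x∈p∩q⁻ (fromList xs) (fromList ys) z∈
  in d (∈-fromList⁻ xs z∈xs , ∈-fromList⁻ ys z∈ys)

-- Cliques

module _ {V : Set} (Adj : V → V → Set) (irrefl : ∀ v → ¬ Adj v v) where

  -- If two indices had the same image, that vertex would be adjacent to itself; so injectivity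
  -- follows from adjacency.
  mkClique : ∀ c {col k} (f : Fin k → V) →
    (∀ i j → i ≢ j → Adj (f i) (f j) × c (f i) (f j) ≡ col) → MonoClique Adj c col k
  mkClique c f pairs = f , injective , pairs
    where
    injective : ∀ {i j} → f i ≡ f j → i ≡ j
    injective {i} {j} eq with i ≟ᶠ j
    ... | yes i≡j = i≡j
    ... | no  i≢j = contradiction (subst (Adj (f i)) (sym eq) (proj₁ (pairs i j i≢j))) (irrefl (f i))

  module _ (adj-sym : ∀ u v → Adj u v → Adj v u) (c : SymColouring V) where

    extend : ∀ {col k} (v : V) (K : MonoClique Adj (proj₁ c) col k) →
      (∀ i → Adj v (proj₁ K i) × proj₁ c v (proj₁ K i) ≡ col) →
      MonoClique Adj (proj₁ c) col (suc k)
    extend {col} {k} v (f , _ , pairs) star = mkClique (proj₁ c) f′ pairs′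
      where
      f′ : Fin (suc k) → V
      f′ zero    = v
      f′ (suc i) = f i

      pairs′ : ∀ i j → i ≢ j → Adj (f′ i) (f′ j) × proj₁ c (f′ i) (f′ j) ≡ col
      pairs′ zero    zero    i≢j = contradiction refl i≢j
      pairs′ zero    (suc j) _   = star j
      pairs′ (suc i) zero    _   =
        adj-sym v (f i) (proj₁ (star i)) , trans (proj₂ c (f i) v) (proj₂ (star i))
      pairs′ (suc i) (suc j) i≢j = pairs i j (i≢j ∘ cong suc)

    module _ {N} (g : Fin N → V) (g-adj : ∀ i j → i ≢ j → Adj (g i) (g j)) where

      -- Records where a clique lives: all vertices `g j` will be joined to `v` in one colour, so
      -- such a clique can be extended by `v`.
      Within : ∀ {col k} → MonoClique Adj (proj₁ c) col k → Set
      Within K = ∀ i → ∃[ j ] proj₁ K i ≡ g j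

      -- Pull the colouring back along `g` to a complete graph on `Fin N`, and push the clique found
      -- there forward.
      arrows-within : ∀ {a b} → Arrows N a b →
        Σ (MonoClique Adj (proj₁ c) red a) Within ⊎ Σ (MonoClique Adj (proj₁ c) blue b) Within
      arrows-within arrows = map image image
        (arrows ((λ i j → proj₁ c (g i) (g j)) , λ i j → proj₂ c (g i) (g j)))
        where
        image : ∀ {col k} → MonoClique KAdj (λ i j → proj₁ c (g i) (g j)) col k →
          Σ (MonoClique Adj (proj₁ c) col k) Within
        image (h , _ , pairs) =
          mkClique (proj₁ c) (g ∘ h) (λ i j i≢j →
            let hi≢hj , eq = pairs i j i≢j in g-adj (h i) (h j) hi≢hj , eq)
          , λ i → h i , refl

-- Kneser graphs

module _ {n r : ℕ} where

  kneser-sym : (p q : KVertex n r) → KneserAdj p q → KneserAdj q p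
  kneser-sym (p , _) (q , _) pq (x , x∈) =
    pq (x , subst (x ∈ˢ_) (∩-comm q p) x∈)

  -- A set disjoint from itself is empty, which positive `r` excludes.
  kneser-irrefl : 0 ℕ.< r → (p : KVertex n r) → ¬ KneserAdj p p
  kneser-irrefl 0<r (p , ∣p∣≡r) pp =
    ℕ.<⇒≢ 0<r (trans (sym (∣⊥∣≡0 n)) (trans (cong ∣_∣ (sym p≡⊥)) ∣p∣≡r))
    where
    p≡⊥ : p ≡ ⊥
    p≡⊥ = trans (sym (∩-idem p)) (Empty-unique pp)

  -- The colouring of blocks is a function on all lists, so lists that do not give an `r`-set need a
  -- default vertex. By `vertexOr-set` it never replaces a block.
  vertexOr : KVertex n r → List (Fin n) → KVertex n r
  vertexOr default xs with ∣ fromList xs ∣ ℕ.≟ r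
  ... | yes eq = fromList xs , eq
  ... | no  _  = default

  vertexOr-set : ∀ {v xs} → Unique xs → length xs ≡ r → proj₁ (vertexOr v xs) ≡ fromList xs
  vertexOr-set {xs = xs} u eq with ∣ fromList xs ∣ ℕ.≟ r
  ... | yes _ = refl
  ... | no ≢  = contradiction (trans (∣fromList∣ u) eq) ≢

-- The first `r` points form `v`; at least `M ℕ.* suc r` points remain, enough for `M` blocks of one
-- colour.
kneser-arrows : ∀ {n r a b M m} → 0 ℕ.< r → r ℕ.+ M ℕ.* suc r ≤ n → m ≤ M →
  Arrows M a (suc b) → Arrows m (suc a) b → KneserArrows n r (suc a) (suc b)
kneser-arrows {n} {r} {a} {b} {M} {m} 0<r big m≤M arrowsM arrowsm c =
  case monochromatic-packing χ r M (drop⁺ r points!) rest≥ of λ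
    { (true  , P) → red-star P ; (false , P) → blue-star P }
  where
  points  = allFin n
  points! = allFin⁺ n

  ∣points∣ : length points ≡ n
  ∣points∣ = length-tabulate (λ i → i)

  r≤ : r ≤ length points
  r≤ = subst (r ≤_) (sym ∣points∣) (ℕ.m+n≤o⇒m≤o r big)

  rest≥ : M ℕ.* suc r ≤ length (drop r points)
  rest≥ = subst (M ℕ.* suc r ≤_) (sym (trans (length-drop r points) (cong (_∸ r) ∣points∣)))
    (m+n≤o⇒n≤o∸m r big)

  v : KVertex n r
  v = fromList (take r points) , trans (∣fromList∣ (take⁺ r points!))
        (trans (length-take r points) (ℕ.m≤n⇒m⊓n≡m r≤))

  χ : List (Fin n) → Bool
  χ = proj₁ c v ∘ vertexOr v

  irrefl : (p : KVertex n r) → ¬ KneserAdj p p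
  irrefl = kneser-irrefl 0<r

  module _ {col} (P : Packing χ r (drop r points) col M) where
    open Packing P
    open Block

    g : Fin M → KVertex n r
    g = vertexOr v ∘ block

    g-set : ∀ i → proj₁ (g i) ≡ fromList (block i)
    g-set i = vertexOr-set (unique (isBlock i)) (size (isBlock i))

    g-adj : ∀ i k → i ≢ k → KneserAdj (g i) (g k)
    g-adj i k i≢k rewrite g-set i | g-set k = fromList-disjoint (disjoint i k i≢k)

    v-g : ∀ i → KneserAdj v (g i) × proj₁ c v (g i) ≡ col
    v-g i = v-adj , colour (isBlock i)
      where
      v-adj : KneserAdj v (g i)
      v-adj rewrite g-set i = fromList-disjoint λ (x∈ , y∈) →
        Unique-++⇒Disjoint (take r points)
          (subst Unique (sym (take++drop≡id r points)) points!)
          (x∈ , within (isBlock i) y∈)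

    -- The map `ι` selects the blocks in play: all `M` of them in the red case, `m` of them in the
    -- blue case.
    star : ∀ {N k} (ι : Fin N → Fin M) (K : MonoClique KneserAdj (proj₁ c) col k) →
      (∀ i → ∃[ j ] proj₁ K i ≡ g (ι j)) → MonoClique KneserAdj (proj₁ c) col (suc k)
    star ι K within = extend KneserAdj irrefl kneser-sym c v K λ i →
      let j , eq = within i
      in subst (λ w → KneserAdj v w × proj₁ c v w ≡ col) (sym eq) (v-g (ι j))

  Goal = MonoClique KneserAdj (proj₁ c) red (suc a) ⊎ MonoClique KneserAdj (proj₁ c) blue (suc b)

  red-star : Packing χ r (drop r points) red M → Goal
  -- A red clique is one vertex short and gains `v`; a blue one already has full size. In
  -- `blue-star` the roles are exchanged.
  red-star P = map (λ (K , within) → star P (λ i → i) K within) proj₁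
    (arrows-within KneserAdj irrefl kneser-sym c (g P) (g-adj P) arrowsM)

  blue-star : Packing χ r (drop r points) blue M → Goal
  blue-star P = map proj₁ (λ (K , within) → star P ι K within)
    (arrows-within KneserAdj irrefl kneser-sym c (g P ∘ ι)
      (λ i j i≢j → g-adj P (ι i) (ι j) (i≢j ∘ inject≤-injective m≤M m≤M i j)) arrowsm)
    where
    ι : Fin m → Fin M
    ι i = inject≤ i m≤M

-- For α = a / d in lowest terms, n = d (M + 1) and r = a (M + 1) work: integrality
-- turns α (M + 1) < 1 into a (M + 1) + 1 ≤ d.
scale : ∀ M (α : ℚ) → 0ℚ < α → α < (+ 1 / suc M) →
  ∃[ k ] ∃[ r ] (α * (+ suc k / 1) ≡ + r / 1) × 0 ℕ.< r × r ℕ.+ M ℕ.* suc r ≤ suc k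
scale M (ℚ.mkℚ (+ 0)       d _) (ℚ.*<* (ℤ.+<+ ()))
scale M (ℚ.mkℚ ℤ.-[1+ _ ]  d _) (ℚ.*<* ())
scale M α@(ℚ.mkℚ (+ suc a) d _) _ α< =
  -- The field `d` is the denominator minus one, and the first witness is the predecessor of
  -- `suc d ℕ.* suc M`.
  M ℕ.+ d ℕ.* suc M , suc a ℕ.* suc M , integral , ℕ.s≤s ℕ.z≤n , bound
  where
  integral : α * (+ (suc d ℕ.* suc M) / 1) ≡ + (suc a ℕ.* suc M) / 1
  integral = ℚ.toℚᵘ-injective (begin
    ℚ.toℚᵘ (α * (+ (suc d ℕ.* suc M) / 1))
      ≈⟨ ℚ.toℚᵘ-homo-* α (+ (suc d ℕ.* suc M) / 1) ⟩
    ℚ.toℚᵘ α ℚᵘ.* ℚ.toℚᵘ (+ (suc d ℕ.* suc M) / 1)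
      ≈⟨ ℚᵘ.*-congˡ {ℚ.toℚᵘ α} (ℚ.toℚᵘ-fromℚᵘ (ℚᵘ.mkℚᵘ (+ (suc d ℕ.* suc M)) 0)) ⟩
    ℚᵘ.mkℚᵘ (+ suc a) d ℚᵘ.* ℚᵘ.mkℚᵘ (+ (suc d ℕ.* suc M)) 0
      ≈⟨ ℚᵘ.*≡* (cong +_ (identity (suc a) (suc d) (suc M))) ⟩
    ℚᵘ.mkℚᵘ (+ (suc a ℕ.* suc M)) 0
      ≈⟨ ℚᵘ.≃-sym (ℚ.toℚᵘ-fromℚᵘ (ℚᵘ.mkℚᵘ (+ (suc a ℕ.* suc M)) 0)) ⟩
    ℚ.toℚᵘ (+ (suc a ℕ.* suc M) / 1) ∎)
    where
    open import Relation.Binary.Reasoning.Setoid ℚᵘ.≃-setoid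
    identity : ∀ x y z → x ℕ.* (y ℕ.* z) ℕ.* 1 ≡ x ℕ.* z ℕ.* (y ℕ.* 1)
    identity = solve-∀

  a[M+1]<d : suc a ℕ.* suc M ℕ.< suc d
  -- Cross-multiply `α<`, after replacing the normalised right side by the literal fraction with
  -- denominator `suc M`.
  a[M+1]<d = subst (suc a ℕ.* suc M ℕ.<_) (ℕ.*-identityˡ (suc d)) (ℤ.drop‿+<+ (ℚᵘ.drop-*<*
    (ℚᵘ.<-respʳ-≃ (ℚ.toℚᵘ-fromℚᵘ (ℚᵘ.mkℚᵘ (+ 1) M)) (ℚ.toℚᵘ-mono-< α<))))

  bound : suc a ℕ.* suc M ℕ.+ M ℕ.* suc (suc a ℕ.* suc M) ≤ suc d ℕ.* suc M
  bound = begin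
    -- Adding one point makes the total factor as `suc M ℕ.* suc R`.
    R ℕ.+ M ℕ.* suc R       ≤⟨ ℕ.n≤1+n _ ⟩
    suc M ℕ.* suc R         ≡⟨ ℕ.*-comm (suc M) (suc R) ⟩
    suc R ℕ.* suc M         ≤⟨ ℕ.*-monoˡ-≤ (suc M) a[M+1]<d ⟩
    suc d ℕ.* suc M         ∎
    where
    open ℕ.≤-Reasoning
    R = suc a ℕ.* suc M

p<q⇒0<q-p : ∀ {p q} → p < q → 0ℚ < q - p
p<q⇒0<q-p {p} {q} p<q = subst (_< q - p) (ℚ.+-inverseʳ p) (ℚ.+-monoˡ-< (ℚ.- p) p<q)

0<p⇒q-p<q : ∀ {p} q → 0ℚ < p → q - p < q
0<p⇒q-p<q {p} q 0<p = subst (q - p <_) (ℚ.+-identityʳ q) (ℚ.+-monoʳ-< q (ℚ.neg-antimono-< 0<p))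

theorem2p1 : (s t M m : ℕ) → 3 ≤ s → 3 ≤ t →
    IsRamseyNumber (s ∸ 1) t M → IsRamseyNumber s (t ∸ 1) m → m ≤ M →
    (ε : ℚ) → 0ℚ < ε → ε < (+ 1 / suc M) →
    Σ ℕ λ k → Σ ℕ λ r →
    (((+ 1 / suc M) - ε) * (+ suc k / 1) ≡ (+ r / 1)) × KneserArrows (suc k) r s t
theorem2p1 (suc s) (suc t) M m _ _ (arrowsM , _) (arrowsm , _) m≤M ε 0<ε ε< =
  -- The upper bound on `ε` makes the density positive, and `0<ε` puts it below the threshold.
  let k , r , eq , 0<r , big = scale M ((+ 1 / suc M) - ε) (p<q⇒0<q-p ε<) (0<p⇒q-p<q (+ 1 / suc M) 0<ε)
  in k , r , eq , kneser-arrows 0<r big m≤M arrowsM arrowsm
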